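{- Let $n$ be odd and $e=2^j+1$ for any integer $j\ge1$ (then $\gcd(e,2^n-1)=1$, so $x\mapsto x^{e}$ is a permutation of $\mathbb{F}_{2^n}$). Then $r_e(\rho)=1$ for every $\rho\in\mathbb{F}_{2^n}\setminus\{0,1\}$, where $$r_e(\rho)=\bigl|\{\tau\in\mathbb{F}_{2^n}:\ \tau^{e}+(\tau+1)^{e}+(\tau+\rho)^{e}=0\}\bigr|.$$ Consequently, for $\psi(x)=x^{2^j+1}$ and every $\rho\in\mathbb{F}_{2^n}\setminus\{0,1\}$, $$\sum_{t,a\in\mathbb{F}_{2^n}}\chi\bigl(\psi(t+\rho a)+\psi(t+a)+\psi(t)\bigr)=0.$$
   Context: $\mathbb{F}_{2^n}$ is the field with $2^n$ elements, $\operatorname{Tr}(x)=\sum_{i=0}^{n-1}x^{2^i}$ is the absolute trace, and $\chi(x)=(-1)^{\operatorname{Tr}(x)}$. -}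

module Defs where

open import Level using (Level; _⊔_) renaming (suc to lsuc)
open import Algebra.Bundles using (CommutativeRing)
import Algebra.Definitions as AlgebraDefinitions
import Algebra.Properties.Monoid.Sum as MonoidSum
import Algebra.Properties.Semiring.Exp as SemiringExp
open import Data.Fin.Base using (Fin; toℕ)
import Data.Fin.Properties as Fin
open import Data.Integer.Base as ℤ using (ℤ; -1ℤ)
import Data.Integer.Properties as ℤ
open import Data.List.Base using (List; allFin; filter; length; map)
open import Data.Nat.Base as ℕ using (ℕ)
open import Function.Bundles using (Inverse)
open import Function.Properties.Inverse using (Inverse⇒Injection)
open import Relation.Binary.Definitions using (Decidable)
open import Relation.Binary.PropositionalEquality using (setoid)
open import Relation.Nullary using (¬_; yes; no)
open import Relation.Nullary.Decidable using (via-injection)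

record Field (c ℓ : Level) : Set (lsuc (c ⊔ ℓ)) where
  field
    commutativeRing : CommutativeRing c ℓ

  open CommutativeRing commutativeRing public
  open AlgebraDefinitions _≈_ using (Invertible)

  field
    1≉0        : ¬ (1# ≈ 0#)
    invertible : ∀ x → ¬ (x ≈ 0#) → Invertible 1# _*_ x

record FiniteField (q : ℕ) (c ℓ : Level) : Set (lsuc (c ⊔ ℓ)) where
  field
    fieldStructure : Field c ℓ

  open Field fieldStructure public hiding (setoid)
  open Field fieldStructure using () renaming (setoid to carrierSetoid) public

  field
    enumeration : Inverse carrierSetoid (setoid (Fin q))

  open SemiringExp semiring using (_^_) public

  -- Decidability of equality is inherited from Fin q.
  infix 4 _≟_
  _≟_ : Decidable _≈_
  _≟_ = via-injection (Inverse⇒Injection enumeration) Fin._≟_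

  element : Fin q → Carrier
  element = Inverse.from enumeration

  -- Every element of the field occurs exactly once, up to _≈_.
  elements : List Carrier
  elements = map element (allFin q)

  ∑ : (Carrier → ℤ) → ℤ
  ∑ f = MonoidSum.sum ℤ.+-0-monoid (λ i → f (element i))

module BinaryField {n : ℕ} {c ℓ : Level} (F : FiniteField (2 ℕ.^ n) c ℓ) where

  open FiniteField F public

  Tr : Carrier → Carrier
  Tr x = MonoidSum.sum +-monoid {n} (λ i → x ^ (2 ℕ.^ toℕ i))

  -- Tr x lies in the prime subfield {0 , 1}; bit reads such an element as
  -- the exponent 0 or 1 of the sign in χ.
  bit : Carrier → ℕ
  bit y with y ≟ 0#
  ... | yes _ = 0
  ... | no  _ = 1

  χ : Carrier → ℤ
  χ x = -1ℤ ℤ.^ bit (Tr x)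

  r : ℕ → Carrier → ℕ
  r e ρ = length (filter (λ τ → τ ^ e + (τ + 1#) ^ e + (τ + ρ) ^ e ≟ 0#) elements)

{-# OPTIONS --safe #-}

-- Write σ x = x ^ 2 ^ j. In characteristic 2,
--   ψ (t + ρ a) + ψ (t + a) + ψ t = ψ (t + (1 + ρ) a) + (σ ρ + ρ) ψ a,
-- and ψ is a permutation, so for fixed a the left side is a permutation of the
-- field in t. Taking a = 1, it has exactly one zero. For every a, the sum of its
-- χ-values over t is the sum of χ over the field, which vanishes because
-- χ (x + 1) = − χ x: the degree n is odd, so Tr 1 = 1.
module Submission where

open import Defs
open import Level using (Level)
open import Data.Integer.Base using (0ℤ)
open import Data.Nat.Base using (ℕ; _≤_; _∸_) renaming (_+_ to _+ℕ_; _^_ to _^ℕ_)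
open import Data.Nat.Divisibility using (_∣_)
open import Data.Nat.GCD using (gcd)
open import Data.Product.Base using (_×_)
open import Function.Definitions using (Bijective)
open import Relation.Binary.PropositionalEquality using (_≡_)
open import Relation.Nullary using (¬_)

open import Algebra.Bundles using (CommutativeMonoid; CommutativeRing)
import Algebra.Properties.CommutativeMonoid.Sum as CommutativeMonoidSum
import Algebra.Properties.CommutativeSemiring.Exp as CommutativeSemiringExp
import Algebra.Properties.Group as GroupProperties
import Algebra.Properties.Monoid.Mult as MonoidMult
import Algebra.Properties.Semiring.Mult as SemiringMult
import Algebra.Solver.Ring as RingSolver
open import Algebra.Solver.Ring.AlmostCommutativeRing
  using (AlmostCommutativeRing; fromCommutativeRing; _-Raw-AlmostCommutative⟶_)
open import Data.Bool.Base using (Bool; true; false)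
import Data.Bool.Properties as Bool
open import Data.Fin.Base using (Fin; zero; suc; toℕ; fromℕ; inject₁)
import Data.Fin.Properties as Fin
open import Data.Integer.Base as ℤ using (ℤ; -1ℤ)
import Data.Integer.Properties as ℤ
open import Data.List.Base using (filter; length; tabulate)
import Data.List.Properties as List
import Data.List.Relation.Unary.All.Properties as All
open import Data.Maybe.Base using (just; nothing)
open import Data.Nat.Base as ℕ using (NonZero; zero; suc)
open import Data.Nat.Divisibility
  using (quotient; m∣n⇒n≡m*quotient; ∣-refl; ∣-trans; ∣1⇒≡1; n∣m*n;
         ∣m⇒∣m*n; ∣n⇒∣m*n; ∣m∣n⇒∣m+n; ∣m+n∣m⇒∣n; m%n≡0⇒n∣m)
open import Data.Nat.DivMod using (_/_; m≡m%n+[m/n]*n; m%n<n)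
open import Data.Nat.GCD using (gcd[m,n]∣m; gcd[m,n]∣n)
import Data.Nat.Properties as ℕ
open import Data.Nat.Solver using (module +-*-Solver)
open import Data.Product.Base using (∃; _,_; proj₁; proj₂)
open import Data.Vec.Functional using (Vector)
open import Function.Base using (_∘_)
open import Function.Bundles using (Inverse)
import Function.Construct.Composition as Composition
import Function.Construct.Symmetry as Symmetry
open import Relation.Binary.Definitions using (WeaklyDecidable)
import Relation.Binary.PropositionalEquality as ≡
import Relation.Binary.Reasoning.Setoid as SetoidReasoning
open import Relation.Nullary using (yes; no; contradiction)
open import Relation.Unary using (Pred; Decidable)

private
  variable
    a c ℓ p : Level

-- Arithmetic of the exponents: divisibility and coprimality.

module _ where
  open +-*-Solver using (solve; _:+_; _:*_; _:=_; con)

  -- In this explicit form `2 ^ n` unfolds to `2 * 2 ^ (k * 2)`, and the ones in `Tr 1#` split into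
  -- a single one and k pairs.
  odd⇒1+k*2 : ∀ n → ¬ (2 ∣ n) → ∃ λ k → n ≡ 1 +ℕ k ℕ.* 2
  odd⇒1+k*2 n odd = n / 2 , ≡.trans (m≡m%n+[m/n]*n n 2)
    (≡.cong (_+ℕ (n / 2) ℕ.* 2) (bit≡1 (m%n<n n 2) (odd ∘ m%n≡0⇒n∣m n 2)))
    where
    bit≡1 : ∀ {b} → b ℕ.< 2 → ¬ (b ≡ 0) → b ≡ 1
    bit≡1 {zero}        _                       b≢0 = contradiction ≡.refl b≢0
    bit≡1 {suc zero}    _                       _   = ≡.refl
    bit≡1 {suc (suc b)} (ℕ.s≤s (ℕ.s≤s ())) _

  -- Modulo m + 1, m is -1, and so are its odd powers. This serves the gcd and, through its
  -- quotient, the exponent that inverts e.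
  m+1∣m^[1+k*2]+1 : ∀ m k → m +ℕ 1 ∣ m ^ℕ (1 +ℕ k ℕ.* 2) +ℕ 1
  m+1∣m^[1+k*2]+1 m zero    = ≡.subst (λ x → m +ℕ 1 ∣ x +ℕ 1) (≡.sym (ℕ.*-identityʳ m)) ∣-refl
  -- With x the previous odd power, the next is `m * (m * x)`. Adding the multiple `m * (m + 1)`
  -- gives a sum visibly divisible by m + 1, with no subtraction.
  m+1∣m^[1+k*2]+1 m (suc k) = ∣m+n∣m⇒∣n
    (≡.subst (m +ℕ 1 ∣_)
      (solve 2 (λ m x → m :* m :* (x :+ con 1) :+ (m :+ con 1)
                     := m :* (m :+ con 1) :+ (m :* (m :* x) :+ con 1)) ≡.refl m (m ^ℕ (1 +ℕ k ℕ.* 2)))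
      (∣m∣n⇒∣m+n (∣n⇒∣m*n (m ℕ.* m) (m+1∣m^[1+k*2]+1 m k)) ∣-refl))
    (n∣m*n m)

  -- For p = 2 ^ n - 1 and k = j: p divides (2 ^ n) ^ j - 1, phrased without truncated subtraction.
  [1+p]^k≡1+c*p : ∀ p k → ∃ λ c → suc p ^ℕ k ≡ 1 +ℕ c ℕ.* p
  [1+p]^k≡1+c*p p zero    = 0 , ≡.refl
  [1+p]^k≡1+c*p p (suc k) with [1+p]^k≡1+c*p p k
  ... | c , eq rewrite eq = 1 +ℕ c +ℕ p ℕ.* c ,
    solve 2 (λ p c → (con 1 :+ p) :* (con 1 :+ c :* p)
                  := con 1 :+ (con 1 :+ c :+ p :* c) :* p) ≡.refl p c

-- A common divisor divides (2 ^ j) ^ n + 1 and (2 ^ n) ^ j − 1, hence 2, but it is odd.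
gcd≡1 : ∀ k j → gcd (2 ^ℕ j +ℕ 1) (2 ^ℕ (1 +ℕ k ℕ.* 2) ∸ 1) ≡ 1
-- Abstracting `2 ^ n`, with its positivity excluding zero, turns `2 ^ n ∸ 1` into a plain variable
-- p.
gcd≡1 k j with 2 ^ℕ (1 +ℕ k ℕ.* 2) in 2^n≡q | ℕ.m^n>0 2 (1 +ℕ k ℕ.* 2)
... | suc p | _ = ∣1⇒≡1 (∣m+n∣m⇒∣n (≡.subst (d ∣_) q≡p+1 d∣q) d∣p)
  where
  n = 1 +ℕ k ℕ.* 2
  d = gcd (2 ^ℕ j +ℕ 1) p
  d∣p : d ∣ p
  d∣p = gcd[m,n]∣n (2 ^ℕ j +ℕ 1) p
  s = proj₁ ([1+p]^k≡1+c*p p j)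
  open ≡.≡-Reasoning
  power : (2 ^ℕ j) ^ℕ n +ℕ 1 ≡ s ℕ.* p +ℕ 2
  power = begin
    (2 ^ℕ j) ^ℕ n +ℕ 1   ≡⟨ ≡.cong (_+ℕ 1) (ℕ.^-*-assoc 2 j n) ⟩
    2 ^ℕ (j ℕ.* n) +ℕ 1  ≡⟨ ≡.cong (λ m → 2 ^ℕ m +ℕ 1) (ℕ.*-comm j n) ⟩
    2 ^ℕ (n ℕ.* j) +ℕ 1  ≡⟨ ≡.cong (_+ℕ 1) (ℕ.^-*-assoc 2 n j) ⟨
    (2 ^ℕ n) ^ℕ j +ℕ 1   ≡⟨ ≡.cong (λ m → m ^ℕ j +ℕ 1) 2^n≡q ⟩
    suc p ^ℕ j +ℕ 1      ≡⟨ ≡.cong (_+ℕ 1) (proj₂ ([1+p]^k≡1+c*p p j)) ⟩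
    suc (s ℕ.* p +ℕ 1)   ≡⟨ ℕ.+-suc (s ℕ.* p) 1 ⟨
    s ℕ.* p +ℕ 2         ∎
  d∣2 : d ∣ 2
  d∣2 = ∣m+n∣m⇒∣n
    (≡.subst (d ∣_) power
      (∣-trans (gcd[m,n]∣m (2 ^ℕ j +ℕ 1) p) (m+1∣m^[1+k*2]+1 (2 ^ℕ j) k)))
    (∣n⇒∣m*n s d∣p)
  -- From d ∣ 2, d also divides the even number 2 ^ n = p + 1; together with d ∣ p this leaves d ∣
  -- 1.
  d∣q : d ∣ 2 ^ℕ n
  d∣q = ∣m⇒∣m*n (2 ^ℕ (k ℕ.* 2)) d∣2
  q≡p+1 : 2 ^ℕ n ≡ p +ℕ 1
  q≡p+1 = ≡.trans 2^n≡q (ℕ.+-comm 1 p)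

-- Counting and summation over finite index sets.

length-filter-tabulate-unique :
  ∀ {A : Set a} {P : Pred A p} (P? : Decidable P) {q} (f : Fin q → A) i →
  P (f i) → (∀ k → P (f k) → k ≡ i) → length (filter P? (tabulate f)) ≡ 1
length-filter-tabulate-unique P? f zero    Pi unique
  rewrite List.filter-accept P? {xs = tabulate (f ∘ suc)} Pi
        | List.filter-none P? (All.tabulate⁺ {f = f ∘ suc} λ k Pk → contradiction (unique (suc k) Pk) λ ())
  = ≡.refl
length-filter-tabulate-unique P? f (suc i) Pi unique
  rewrite List.filter-reject P? {xs = tabulate (f ∘ suc)}
            (λ P0 → contradiction (unique zero P0) λ ())
  = length-filter-tabulate-unique P? (f ∘ suc) i Pi (λ k → Fin.suc-injective ∘ unique (suc k))

module _ (M : CommutativeMonoid c ℓ) where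
  open CommutativeMonoid M
  open CommutativeMonoidSum M using (sum; sum-cong-≋; sum-replicate-zero)

  sum-single : ∀ {q} (f : Vector Carrier q) i → (∀ k → ¬ (k ≡ i) → f k ≈ ε) → sum f ≈ f i
  sum-single {suc q} f zero    f≈ε = trans
    (∙-congˡ (trans (sum-cong-≋ (λ k → f≈ε (suc k) λ ())) (sum-replicate-zero q)))
    (identityʳ _)
  sum-single         f (suc i) f≈ε = trans
    (∙-cong (f≈ε zero λ ())
      (sum-single (f ∘ suc) i (λ k k≢i → f≈ε (suc k) (k≢i ∘ Fin.suc-injective))))
    (identityˡ _)

private module ℤSum = CommutativeMonoidSum ℤ.+-0-commutativeMonoid

sum-neg : ∀ {m} (f : Vector ℤ m) → ℤSum.sum (λ i → ℤ.- f i) ≡ ℤ.- ℤSum.sum f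
sum-neg {zero}  f = ≡.refl
sum-neg {suc m} f = ≡.trans (≡.cong (ℤ._+_ (ℤ.- f zero)) (sum-neg (f ∘ suc)))
  (≡.sym (ℤ.neg-distrib-+ (f zero) _))

-- Finite fields of order q: reindexing, the identity x ^ q = x, counting.

module FiniteFieldProperties {q : ℕ} (F : FiniteField q c ℓ) where
  open FiniteField F hiding (zero)
  open CommutativeSemiringExp commutativeSemiring
    using (^-congˡ; ^-assocʳ)
  open MonoidMult +-monoid using () renaming (_×_ to infixl 8 _·_)
  open SetoidReasoning carrierSetoid

  index : Carrier → Fin q
  index = Inverse.to enumeration

  element-index : ∀ x → element (index x) ≈ x
  element-index = Inverse.strictlyInverseʳ enumeration

  element≈⇒≡index : ∀ {i x} → element i ≈ x → i ≡ index x
  element≈⇒≡index {i} eq =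
    ≡.trans (≡.sym (Inverse.strictlyInverseˡ enumeration i)) (Inverse.to-cong enumeration eq)

  q≢0 : NonZero q
  q≢0 = Fin.nonZeroIndex (index 0#)

  module _ (M : CommutativeMonoid a p) where
    open CommutativeMonoid M using () renaming (Carrier to A; _≈_ to _≈ᴹ_; trans to transᴹ)
    open CommutativeMonoidSum M using (sum; sum-cong-≋; sum-permute)

    -- Conjugating π by the enumeration gives a permutation of `Fin q`. The enumeration round trip
    -- holds only up to `≈`, so f has to respect it. The monoid is arbitrary because sums in the
    -- field, products in the field and integer sums are all reindexed.
    sum-reindex : (f : Carrier → A) → (∀ {x y} → x ≈ y → f x ≈ᴹ f y) →
                  (π : Inverse carrierSetoid carrierSetoid) →
                  sum (λ i → f (element i)) ≈ᴹ sum (λ i → f (Inverse.to π (element i)))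
    sum-reindex f f-cong π = transᴹ
      (sum-permute (λ i → f (element i))
        (Composition.inverse (Symmetry.inverse enumeration)
          (Composition.inverse π enumeration)))
      (sum-cong-≋ {q} (λ i → f-cong (element-index (Inverse.to π (element i)))))

  *-cancelʳ-≉0 : ∀ {x y z} → ¬ (z ≈ 0#) → x * z ≈ y * z → x ≈ y
  *-cancelʳ-≉0 {x} {y} {z} z≉0 xz≈yz with invertible z z≉0
  ... | z⁻¹ , _ , zz⁻¹≈1 = begin
    x              ≈⟨ *-identityʳ x ⟨
    x * 1#         ≈⟨ *-congˡ zz⁻¹≈1 ⟨
    x * (z * z⁻¹)  ≈⟨ *-assoc x z z⁻¹ ⟨
    x * z * z⁻¹    ≈⟨ *-congʳ xz≈yz ⟩
    y * z * z⁻¹    ≈⟨ *-assoc y z z⁻¹ ⟩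
    y * (z * z⁻¹)  ≈⟨ *-congˡ zz⁻¹≈1 ⟩
    y * 1#         ≈⟨ *-identityʳ y ⟩
    y              ∎

  *-≉0 : ∀ {x y} → ¬ (x ≈ 0#) → ¬ (y ≈ 0#) → ¬ (x * y ≈ 0#)
  *-≉0 x≉0 y≉0 xy≈0 = x≉0 (*-cancelʳ-≉0 y≉0 (trans xy≈0 (sym (zeroˡ _))))

  product-≉0 : ∀ {m} (f : Vector Carrier m) → (∀ i → ¬ (f i ≈ 0#)) →
               ¬ (CommutativeMonoidSum.sum *-commutativeMonoid f ≈ 0#)
  product-≉0 {zero}  f f≉0 = 1≉0
  product-≉0 {suc m} f f≉0 = *-≉0 (f≉0 zero) (product-≉0 (f ∘ suc) (f≉0 ∘ suc))

  ^-≉0 : ∀ {x} m → ¬ (x ≈ 0#) → ¬ (x ^ m ≈ 0#)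
  ^-≉0 zero    x≉0 = 1≉0
  ^-≉0 (suc m) x≉0 = *-≉0 x≉0 (^-≉0 m x≉0)

  translation : Carrier → Inverse carrierSetoid carrierSetoid
  translation y = record
    { to        = _+ y
    ; from      = _- y
    ; to-cong   = +-congʳ
    ; from-cong = +-congʳ
    ; inverse   = (λ {x} eq → trans (+-congʳ eq) (//-rightDividesˡ y x))
                , (λ {x} eq → trans (+-congʳ eq) (//-rightDividesʳ y x))
    }
    where open GroupProperties +-group using (//-rightDividesˡ; //-rightDividesʳ)

  scaling : ∀ x → ¬ (x ≈ 0#) → Inverse carrierSetoid carrierSetoid
  scaling x x≉0 with invertible x x≉0
  ... | x⁻¹ , x⁻¹x≈1 , xx⁻¹≈1 = record
    { to        = x *_
    ; from      = x⁻¹ *_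
    ; to-cong   = *-congˡ
    ; from-cong = *-congˡ
    ; inverse   = (λ eq → trans (*-congˡ eq) (cancel xx⁻¹≈1))
                , (λ eq → trans (*-congˡ eq) (cancel x⁻¹x≈1))
    }
    where
    cancel : ∀ {u v w} → u * v ≈ 1# → u * (v * w) ≈ w
    cancel uv≈1 = trans (sym (*-assoc _ _ _)) (trans (*-congʳ uv≈1) (*-identityˡ _))

  -- Translation by y preserves the sum of all elements but adds q · y to it.
  q·y≈0 : ∀ y → q · y ≈ 0#
  q·y≈0 y = sym (GroupProperties.∙-cancelˡ +-group (sum element) _ _ (begin
    sum element + 0#                 ≈⟨ +-identityʳ _ ⟩
    sum element                      ≈⟨ sum-reindex +-commutativeMonoid (λ x → x) (λ eq → eq) (translation y) ⟩
    sum (λ i → element i + y)        ≈⟨ ∑-distrib-+ element (λ _ → y) ⟩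
    sum element + sum {q} (λ _ → y)  ≈⟨ +-congˡ (sum-replicate q) ⟩
    sum element + q · y              ∎))
    where open CommutativeMonoidSum +-commutativeMonoid

  -- Overrides a factor at 0 in products over the whole field. As a named function with two
  -- evaluation rules it can be evaluated at `x * y` while the case split is on y.
  caseZero : Carrier → Carrier → Carrier → Carrier
  caseZero y z w with y ≟ 0#
  ... | yes _ = z
  ... | no  _ = w

  caseZero-≈0 : ∀ {y z w} → y ≈ 0# → caseZero y z w ≈ z
  caseZero-≈0 {y} y≈0 with y ≟ 0#
  ... | yes _   = refl
  ... | no  y≉0 = contradiction y≈0 y≉0

  caseZero-≉0 : ∀ {y z w} → ¬ (y ≈ 0#) → caseZero y z w ≈ w
  caseZero-≉0 {y} y≉0 with y ≟ 0#
  ... | yes y≈0 = contradiction y≈0 y≉0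
  ... | no  _   = refl

  -- Scaling by x ≉ 0 permutes the nonzero elements. Products run over all
  -- elements, with 0 replaced by 1, so the element 0 contributes an extra factor x.
  x^q≈x-≉0 : ∀ {x} → ¬ (x ≈ 0#) → x ^ q ≈ x
  x^q≈x-≉0 {x} x≉0 = *-cancelʳ-≉0 (product-≉0 (λ i → unit (element i)) (λ i → unit-≉0 (element i))) (begin
    x ^ q * ∏ unit
      ≈⟨ *-congʳ (sum-replicate q) ⟨
    ∏ (λ _ → x) * ∏ unit
      ≈⟨ ∑-distrib-+ (λ _ → x) (λ i → unit (element i)) ⟨
    ∏ (λ y → x * unit y)
      ≈⟨ sum-cong-≋ (λ i → scale (element i)) ⟩
    ∏ (λ y → extra y * unit (x * y))
      ≈⟨ ∑-distrib-+ (λ i → extra (element i)) (λ i → unit (x * element i)) ⟩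
    ∏ extra * ∏ (λ y → unit (x * y))
      ≈⟨ *-cong ∏extra (sym (sum-reindex *-commutativeMonoid unit unit-cong (scaling x x≉0))) ⟩
    x * ∏ unit
      ∎)
    where
    open CommutativeMonoidSum *-commutativeMonoid
    ∏ : (Carrier → Carrier) → Carrier
    ∏ f = sum (λ i → f (element i))
    unit extra : Carrier → Carrier
    unit y  = caseZero y 1# y
    extra y = caseZero y x 1#
    unit-≉0 : ∀ y → ¬ (unit y ≈ 0#)
    unit-≉0 y with y ≟ 0#
    ... | yes _   = 1≉0
    ... | no  y≉0 = y≉0
    unit-cong : ∀ {y z} → y ≈ z → unit y ≈ unit z
    unit-cong {y} {z} y≈z with y ≟ 0#
    ... | yes y≈0 = sym (caseZero-≈0 (trans (sym y≈z) y≈0))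
    ... | no  y≉0 = trans y≈z (sym (caseZero-≉0 (y≉0 ∘ trans y≈z)))
    scale : ∀ y → x * unit y ≈ extra y * unit (x * y)
    scale y with y ≟ 0#
    ... | yes y≈0 = *-congˡ (sym (caseZero-≈0 (trans (*-congˡ y≈0) (zeroʳ x))))
    ... | no  y≉0 = sym (trans (*-identityˡ _) (caseZero-≉0 (*-≉0 x≉0 y≉0)))
    ∏extra : ∏ extra ≈ x
    ∏extra = trans
      (sum-single *-commutativeMonoid (λ i → extra (element i)) (index 0#)
        (λ k k≢0 → caseZero-≉0 (k≢0 ∘ element≈⇒≡index)))
      (caseZero-≈0 (element-index 0#))

  x^q≈x : ∀ x → x ^ q ≈ x
  x^q≈x x with x ≟ 0#
  ... | no  x≉0 = x^q≈x-≉0 x≉0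
  -- At 0 the exponent must be nonzero, as `0# ^ 0` is `1#`; q is nonzero because `Fin q` contains
  -- the index of 0.
  ... | yes x≈0 = trans (^-congˡ q x≈0) (trans (0^ q {{q≢0}}) (sym x≈0))
    where
    0^ : ∀ m .{{_ : NonZero m}} → 0# ^ m ≈ 0#
    0^ (suc m) = zeroˡ _

  x^q^m≈x : ∀ m x → x ^ (q ℕ.^ m) ≈ x
  x^q^m≈x zero    x = *-identityʳ x
  x^q^m≈x (suc m) x = begin
    x ^ (q ℕ.* q ℕ.^ m)  ≈⟨ ^-assocʳ x q (q ℕ.^ m) ⟨
    (x ^ q) ^ (q ℕ.^ m)  ≈⟨ x^q^m≈x m (x ^ q) ⟩
    x ^ q                ≈⟨ x^q≈x x ⟩
    x                    ∎

  -- The list holds a representative that is only `≈` to x, so P has to respect `≈`; uniqueness up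
  -- to `≈` becomes uniqueness of the index.
  length-filter-elements : ∀ {P : Pred Carrier p} (P? : Decidable P) →
                           (∀ {x y} → x ≈ y → P x → P y) →
                           ∀ x → P x → (∀ y → P y → y ≈ x) → length (filter P? elements) ≡ 1
  length-filter-elements P? resp x Px unique = ≡.trans
    (≡.cong (length ∘ filter P?) (List.map-tabulate (λ i → i) element))
    (length-filter-tabulate-unique P? element (index x) (resp (sym (element-index x)) Px)
      (λ k → element≈⇒≡index ∘ unique (element k)))

-- Commutative rings of characteristic 2.

module Characteristic2 (R : CommutativeRing c ℓ) where
  open CommutativeRing R hiding (zero)
  open CommutativeSemiringExp commutativeSemiring
  open SetoidReasoning setoid

  1^m≈1 : ∀ m → 1# ^ m ≈ 1#
  1^m≈1 zero    = refl
  1^m≈1 (suc m) = trans (*-identityˡ _) (1^m≈1 m)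

  module _ (1+1≈0 : 1# + 1# ≈ 0#) where

    private
      almostCommutativeRing : AlmostCommutativeRing c ℓ
      almostCommutativeRing = fromCommutativeRing R

      fromBool : Bool → Carrier
      fromBool true  = 1#
      fromBool false = 0#

      1≈-1 : 1# ≈ - 1#
      1≈-1 = GroupProperties.inverseˡ-unique +-group 1# 1# 1+1≈0

      -- The prime field {false , true} as coefficient ring makes the solver reduce modulo 2.
      morphism : CommutativeRing.rawRing Bool.xor-∧-commutativeRing
                 -Raw-AlmostCommutative⟶ almostCommutativeRing
      morphism = record
        { ⟦_⟧    = fromBool
        ; +-homo = λ { true  true  → sym 1+1≈0
                     ; true  false → sym (+-identityʳ _)
                     ; false y     → sym (+-identityˡ _) }
        ; *-homo = λ { true  y → sym (*-identityˡ _) ; false y → sym (zeroˡ _) }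
        ; -‿homo = λ { true → 1≈-1 ; false → sym (GroupProperties.ε⁻¹≈ε +-group) }
        ; 0-homo = refl
        ; 1-homo = refl
        }

      coefficient-≟ : WeaklyDecidable (λ x y → fromBool x ≈ fromBool y)
      coefficient-≟ x y with x Bool.≟ y
      ... | yes ≡.refl = just refl
      ... | no  _      = nothing

    open RingSolver (CommutativeRing.rawRing Bool.xor-∧-commutativeRing)
      almostCommutativeRing morphism coefficient-≟ using (solve; _:+_; _:*_; _:=_; con)

    -- Squaring is additive because the cross terms cancel; iterate m times. At m = 0 the power
    -- unfolds to `x * 1#`, which explains the factors `con true`.
    frobenius-+ : ∀ m x y → (x + y) ^ (2 ℕ.^ m) ≈ x ^ (2 ℕ.^ m) + y ^ (2 ℕ.^ m)
    frobenius-+ zero    = solve 2 (λ x y → (x :+ y) :* con true := x :* con true :+ y :* con true) refl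
    frobenius-+ (suc m) x y = begin
      (x + y) ^ (2 ℕ.* 2 ℕ.^ m)                      ≈⟨ ^-assocʳ (x + y) 2 (2 ℕ.^ m) ⟨
      ((x + y) ^ 2) ^ (2 ℕ.^ m)                      ≈⟨ ^-congˡ (2 ℕ.^ m) (square x y) ⟩
      (x ^ 2 + y ^ 2) ^ (2 ℕ.^ m)                    ≈⟨ frobenius-+ m (x ^ 2) (y ^ 2) ⟩
      (x ^ 2) ^ (2 ℕ.^ m) + (y ^ 2) ^ (2 ℕ.^ m)      ≈⟨ +-cong (^-assocʳ x 2 (2 ℕ.^ m)) (^-assocʳ y 2 (2 ℕ.^ m)) ⟩
      x ^ (2 ℕ.* 2 ℕ.^ m) + y ^ (2 ℕ.* 2 ℕ.^ m)      ∎
      where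
      square : ∀ x y → (x + y) ^ 2 ≈ x ^ 2 + y ^ 2
      square = solve 2 (λ x y → (x :+ y) :* ((x :+ y) :* con true)
                             := x :* (x :* con true) :+ y :* (y :* con true)) refl

    x^[2^j+1] : ∀ j x → x ^ (2 ℕ.^ j ℕ.+ 1) ≈ x ^ (2 ℕ.^ j) * x
    x^[2^j+1] j x = trans (^-homo-* x (2 ℕ.^ j) 1) (*-congˡ (*-identityʳ x))

    -- Completing the form x ^ (2 ^ j) * x, as one completes a square.
    three-powers : ∀ j t a ρ → let e = 2 ℕ.^ j ℕ.+ 1 in
      t ^ e + (t + a) ^ e + (t + ρ * a) ^ e ≈ (t + (1# + ρ) * a) ^ e + (ρ ^ (2 ℕ.^ j) + ρ) * a ^ e
    three-powers j t a ρ = begin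
      t ^ e + (t + a) ^ e + (t + ρ * a) ^ e
        ≈⟨ +-cong (+-cong (x^[2^j+1] j t) (expand t a (σ a) refl))
                  (expand t (ρ * a) (σ ρ * σ a) (^-distrib-* ρ a (2 ℕ.^ j))) ⟩
      σ t * t + (σ t + σ a) * (t + a) + (σ t + σ ρ * σ a) * (t + ρ * a)
        -- With σ t, σ a, σ ρ as independent unknowns s, b, r, three copies of s t reduce to one,
        -- and (1 + r)(1 + ρ) + (r + ρ) = 1 + r ρ modulo 2.
        ≈⟨ solve 6 (λ t a ρ s b r →
             s :* t :+ (s :+ b) :* (t :+ a) :+ (s :+ r :* b) :* (t :+ ρ :* a)
             := (s :+ (con true :+ r) :* b) :* (t :+ (con true :+ ρ) :* a) :+ (r :+ ρ) :* (b :* a))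
             refl t a ρ (σ t) (σ a) (σ ρ) ⟩
      (σ t + (1# + σ ρ) * σ a) * (t + (1# + ρ) * a) + (σ ρ + ρ) * (σ a * a)
        ≈⟨ +-cong (expand t ((1# + ρ) * a) ((1# + σ ρ) * σ a) σ[1+ρ]a) (*-congˡ (x^[2^j+1] j a)) ⟨
      (t + (1# + ρ) * a) ^ e + (σ ρ + ρ) * a ^ e
        ∎
      where
      e = 2 ℕ.^ j ℕ.+ 1
      σ : Carrier → Carrier
      σ x = x ^ (2 ℕ.^ j)
      -- The parameter z lets σ of a product enter already split into factors.
      expand : ∀ x y z → σ y ≈ z → (x + y) ^ e ≈ (σ x + z) * (x + y)
      expand x y z σy≈z = trans (x^[2^j+1] j (x + y)) (*-congʳ (trans (frobenius-+ j x y) (+-congˡ σy≈z)))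
      σ[1+ρ]a : σ ((1# + ρ) * a) ≈ (1# + σ ρ) * σ a
      σ[1+ρ]a = trans (^-distrib-* (1# + ρ) a (2 ℕ.^ j))
        (*-congʳ (trans (frobenius-+ j 1# ρ) (+-congʳ (1^m≈1 (2 ℕ.^ j)))))

-- Trace and additive character in odd degree.

module OddDegree (k : ℕ) (F : FiniteField (2 ^ℕ (1 +ℕ k ℕ.* 2)) c ℓ) where
  n : ℕ
  n = 1 +ℕ k ℕ.* 2

  open BinaryField {n} F hiding (zero)
  open FiniteFieldProperties F
  open CommutativeSemiringExp commutativeSemiring using (^-congˡ; ^-congʳ; ^-assocʳ; ^-homo-*)
  open SemiringMult semiring using (×-homo-1; ×-congʳ; ×-assocˡ; ×1-homo-*) renaming (_×_ to infixl 8 _·_)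
  open CommutativeMonoidSum +-commutativeMonoid
    using (sum; sum-cong-≋; sum-replicate; sum-replicate-zero; ∑-distrib-+; sum-init-last)
  open SetoidReasoning carrierSetoid

  -- The characteristic comes from the order: (1 + 1) ^ n is 2 ^ n times 1, which is 0, while powers
  -- of a nonzero element are nonzero.
  1+1≈0 : 1# + 1# ≈ 0#
  1+1≈0 with (1# + 1#) ≟ 0#
  ... | yes eq  = eq
  ... | no  neq = contradiction (trans (sym (2^m·1 n)) (q·y≈0 1#)) (^-≉0 n neq)
    where
    2^m·1 : ∀ m → (2 ℕ.^ m) · 1# ≈ (1# + 1#) ^ m
    2^m·1 zero    = ×-homo-1 1#
    2^m·1 (suc m) = trans (×1-homo-* 2 (2 ℕ.^ m)) (*-cong (+-congˡ (+-identityʳ 1#)) (2^m·1 m))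

  open Characteristic2 commutativeRing

  Tr-cong : ∀ {x y} → x ≈ y → Tr x ≈ Tr y
  Tr-cong x≈y = sum-cong-≋ {n} (λ i → ^-congˡ (2 ℕ.^ toℕ i) x≈y)

  Tr-+ : ∀ x y → Tr (x + y) ≈ Tr x + Tr y
  Tr-+ x y = trans (sum-cong-≋ {n} (λ i → frobenius-+ 1+1≈0 (toℕ i) x y))
    (∑-distrib-+ {n} (λ i → x ^ (2 ℕ.^ toℕ i)) (λ i → y ^ (2 ℕ.^ toℕ i)))

  -- Of the n = 1 + k * 2 ones, all but the first cancel in pairs.
  Tr-1 : Tr 1# ≈ 1#
  Tr-1 = begin
    Tr 1#                ≈⟨ sum-cong-≋ {n} (λ i → 1^m≈1 (2 ℕ.^ toℕ i)) ⟩
    sum {n} (λ _ → 1#)   ≈⟨ sum-replicate n ⟩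
    1# + (k ℕ.* 2) · 1#  ≈⟨ +-congˡ (×-assocˡ 1# k 2) ⟨
    1# + k · (2 · 1#)    ≈⟨ +-congˡ (×-congʳ k (trans (+-congˡ (+-identityʳ 1#)) 1+1≈0)) ⟩
    1# + k · 0#          ≈⟨ +-congˡ (sum-replicate k) ⟨
    1# + sum {k} (λ _ → 0#)  ≈⟨ +-congˡ (sum-replicate-zero k) ⟩
    1# + 0#              ≈⟨ +-identityʳ 1# ⟩
    1#                   ∎

  square-sum : ∀ {m} (f : Vector Carrier m) → sum f ^ 2 ≈ sum (λ i → f i ^ 2)
  square-sum {zero}  f = zeroˡ _
  square-sum {suc m} f = trans (frobenius-+ 1+1≈0 1 _ _) (+-congˡ (square-sum (f ∘ suc)))

  -- Both sides of x + Tr x ^ 2 ≈ Tr x + x are the sum of x ^ 2 ^ i for 0 ≤ i ≤ n.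
  Tr-idem : ∀ x → Tr x ^ 2 ≈ Tr x
  Tr-idem x = GroupProperties.∙-cancelˡ +-group x _ _ (begin
    x + Tr x ^ 2
      ≈⟨ +-cong (sym (*-identityʳ x)) (square-sum {n} (λ i → power (toℕ i))) ⟩
    power 0 + sum {n} (λ i → power (toℕ i) ^ 2)
      ≈⟨ +-congˡ (sum-cong-≋ {n} (λ i → square-power (toℕ i))) ⟩
    sum {suc n} (λ i → power (toℕ i))
      ≈⟨ sum-init-last {n} (λ i → power (toℕ i)) ⟩
    sum {n} (λ i → power (toℕ (inject₁ i))) + power (toℕ (fromℕ n))
      ≈⟨ +-cong (sum-cong-≋ {n} (λ i → reflexive (≡.cong power (Fin.toℕ-inject₁ i))))
                (trans (reflexive (≡.cong power (Fin.toℕ-fromℕ n))) (x^q≈x x)) ⟩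
    Tr x + x
      ≈⟨ +-comm (Tr x) x ⟩
    x + Tr x
      ∎)
    where
    power : ℕ → Carrier
    power i = x ^ (2 ℕ.^ i)
    square-power : ∀ i → power i ^ 2 ≈ power (suc i)
    square-power i = trans (^-assocʳ x (2 ℕ.^ i) 2) (^-congʳ x (ℕ.*-comm (2 ℕ.^ i) 2))

  bit-≈0 : ∀ {y} → y ≈ 0# → bit y ≡ 0
  bit-≈0 {y} y≈0 with y ≟ 0#
  ... | yes _   = ≡.refl
  ... | no  y≉0 = contradiction y≈0 y≉0

  bit-≉0 : ∀ {y} → ¬ (y ≈ 0#) → bit y ≡ 1
  bit-≉0 {y} y≉0 with y ≟ 0#
  ... | yes y≈0 = contradiction y≈0 y≉0
  ... | no  _   = ≡.refl

  χ-cong : ∀ {x y} → x ≈ y → χ x ≡ χ y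
  χ-cong {x} {y} x≈y = ≡.cong (-1ℤ ℤ.^_) bits
    where
    bits : bit (Tr x) ≡ bit (Tr y)
    bits with Tr x ≟ 0#
    ... | yes Trx≈0 = ≡.sym (bit-≈0 (trans (sym (Tr-cong x≈y)) Trx≈0))
    ... | no  Trx≉0 = ≡.sym (bit-≉0 (Trx≉0 ∘ trans (Tr-cong x≈y)))

  -- By additivity and `Tr-1` the trace moves by 1, which exchanges its two possible values 0 and 1.
  χ[x+1] : ∀ x → χ (x + 1#) ≡ ℤ.- χ x
  χ[x+1] x with Tr x ≟ 0#
  ... | yes Trx≈0 = ≡.cong (-1ℤ ℤ.^_) (bit-≉0 (λ eq → 1≉0 (begin
    1#              ≈⟨ +-identityˡ 1# ⟨
    0# + 1#         ≈⟨ +-cong Trx≈0 Tr-1 ⟨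
    Tr x + Tr 1#    ≈⟨ Tr-+ x 1# ⟨
    Tr (x + 1#)     ≈⟨ eq ⟩
    0#              ∎)))
  ... | no  Trx≉0 = ≡.cong (-1ℤ ℤ.^_) (bit-≈0 (begin
    Tr (x + 1#)     ≈⟨ Tr-+ x 1# ⟩
    Tr x + Tr 1#    ≈⟨ +-cong Trx≈1 Tr-1 ⟩
    1# + 1#         ≈⟨ 1+1≈0 ⟩
    0#              ∎))
    where
    -- `Tr-idem` makes the trace a root of z ^ 2 = z; cancelling a nonzero z leaves z = 1.
    Trx≈1 : Tr x ≈ 1#
    Trx≈1 = *-cancelʳ-≉0 Trx≉0 (begin
      Tr x * Tr x         ≈⟨ *-congˡ (*-identityʳ _) ⟨
      Tr x ^ 2            ≈⟨ Tr-idem x ⟩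
      Tr x                ≈⟨ *-identityˡ _ ⟨
      1# * Tr x           ∎)

  -- Reindexing by x ↦ x + 1 shows the sum equal to its own negative.
  ∑χ≡0 : ∑ χ ≡ 0ℤ
  ∑χ≡0 = self-negative _ (≡.trans
    (sum-reindex ℤ.+-0-commutativeMonoid χ χ-cong (translation 1#))
    (≡.trans (ℤSum.sum-cong-≗ (λ i → χ[x+1] (element i))) (sum-neg (λ i → χ (element i)))))
    where
    self-negative : ∀ z → z ≡ ℤ.- z → z ≡ 0ℤ
    self-negative (ℤ.+ zero)  _  = ≡.refl
    self-negative (ℤ.+ suc m) ()
    self-negative (ℤ.-[1+ m ]) ()

  -- The power map with exponent 2 ^ j + 1, the zero count and the double sum.

  module Gold (j : ℕ) where
    e h A : ℕ
    e = 2 ^ℕ j +ℕ 1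
    h = 2 ^ℕ (k ℕ.* 2)
    A = quotient (m+1∣m^[1+k*2]+1 (2 ^ℕ j) k)

    -- `A * h` is an explicit inverse of e modulo 2 ^ n - 1: there `e * A` is congruent to 2, and h,
    -- half of 2 ^ n, inverts 2.
    root : Carrier → Carrier
    root x = x ^ (A ℕ.* h)

    -- e * A = 2 ^ (j * n) + 1 and 2 * h = 2 ^ n, so x ^ (e * A * h) is
    -- (x * x) ^ h because x ^ 2 ^ n ≈ x.
    x^[e*[A*h]]≈x : ∀ x → x ^ (e ℕ.* (A ℕ.* h)) ≈ x
    x^[e*[A*h]]≈x x = begin
      x ^ (e ℕ.* (A ℕ.* h))                ≈⟨ ^-congʳ x exponent ⟩
      x ^ ((q′ ℕ.^ j ℕ.+ 1) ℕ.* h)         ≈⟨ ^-assocʳ x (q′ ℕ.^ j ℕ.+ 1) h ⟨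
      (x ^ (q′ ℕ.^ j ℕ.+ 1)) ^ h           ≈⟨ ^-congˡ h (^-homo-* x (q′ ℕ.^ j) 1) ⟩
      (x ^ (q′ ℕ.^ j) * x ^ 1) ^ h         ≈⟨ ^-congˡ h (*-congʳ (x^q^m≈x j x)) ⟩
      (x ^ 2) ^ h                          ≈⟨ ^-assocʳ x 2 h ⟩
      x ^ q′                               ≈⟨ x^q≈x x ⟩
      x                                    ∎
      where
      q′ = 2 ^ℕ n
      exponent : e ℕ.* (A ℕ.* h) ≡ (q′ ℕ.^ j ℕ.+ 1) ℕ.* h
      -- (2 ^ j) ^ n is rewritten as (2 ^ n) ^ j, so that `x^q^m≈x` can remove it.
      exponent = ≡.trans (≡.sym (ℕ.*-assoc e A h)) (≡.cong (ℕ._* h)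
        (≡.trans (≡.sym (m∣n⇒n≡m*quotient (m+1∣m^[1+k*2]+1 (2 ^ℕ j) k)))
          (≡.cong (_+ℕ 1) (≡.trans (ℕ.^-*-assoc 2 j n)
            (≡.trans (≡.cong (2 ^ℕ_) (ℕ.*-comm j n)) (≡.sym (ℕ.^-*-assoc 2 n j)))))))

    root-^ : ∀ x → root (x ^ e) ≈ x
    root-^ x = trans (^-assocʳ x e (A ℕ.* h)) (x^[e*[A*h]]≈x x)

    ^-root : ∀ x → root x ^ e ≈ x
    ^-root x = trans (^-assocʳ x (A ℕ.* h) e) (trans (^-congʳ x (ℕ.*-comm (A ℕ.* h) e)) (x^[e*[A*h]]≈x x))

    power : Inverse carrierSetoid carrierSetoid
    power = record
      { to        = _^ e
      ; from      = root
      ; to-cong   = ^-congˡ e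
      ; from-cong = ^-congˡ (A ℕ.* h)
      ; inverse   = (λ {x} eq → trans (^-congˡ e eq) (^-root x))
                  , (λ {x} eq → trans (^-congˡ (A ℕ.* h) eq) (root-^ x))
      }

    power-bijective : Bijective _≈_ _≈_ (_^ e)
    power-bijective = (λ {x} {y} eq → trans (sym (root-^ x)) (Inverse.inverseʳ power eq))
                    , (λ y → root y , Inverse.inverseˡ power)

    -- The map t ↦ (t + b) ^ e + d, which is the right side of `three-powers` as a function of t.
    -- Its inverse yields the unique zero and permits reindexing.
    affinePower : Carrier → Carrier → Inverse carrierSetoid carrierSetoid
    affinePower b d = Composition.inverse (translation b) (Composition.inverse power (translation d))

    r≡1 : ∀ ρ → r e ρ ≡ 1
    -- The only zero is the preimage of 0 under this permutation.
    r≡1 ρ = length-filter-elements _ (λ x≈y → trans (sym (f-cong x≈y))) (from 0#)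
      (trans (f≈to _) (strictlyInverseˡ 0#))
      (λ y fy≈0 → trans (sym (strictlyInverseʳ y)) (from-cong (trans (sym (f≈to y)) fy≈0)))
      where
      open Inverse (affinePower ((1# + ρ) * 1#) ((ρ ^ (2 ^ℕ j) + ρ) * 1# ^ e))
      f : Carrier → Carrier
      f τ = τ ^ e + (τ + 1#) ^ e + (τ + ρ) ^ e
      f-cong : ∀ {x y} → x ≈ y → f x ≈ f y
      f-cong x≈y = +-cong (+-cong (^-congˡ e x≈y) (^-congˡ e (+-congʳ x≈y))) (^-congˡ e (+-congʳ x≈y))
      f≈to : ∀ τ → f τ ≈ to τ
      -- Writing ρ as `ρ * 1#` fits the count to `three-powers` at a = 1.
      f≈to τ = trans (+-congˡ (^-congˡ e (+-congˡ (sym (*-identityʳ ρ))))) (three-powers 1+1≈0 j τ 1# ρ)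

    ∑∑χ≡0 : ∀ ρ → ∑ (λ t → ∑ (λ a → χ ((t + ρ * a) ^ e + (t + a) ^ e + t ^ e))) ≡ 0ℤ
    -- The order of summation is exchanged because the permutation is in t for fixed a; each inner
    -- sum vanishes, also at a = 0.
    ∑∑χ≡0 ρ = ≡.trans (ℤSum.∑-comm (λ t a → χ (g (element a) (element t))))
      (≡.trans (ℤSum.sum-cong-≗ (λ a → inner (element a))) (ℤSum.sum-replicate-zero (2 ^ℕ n)))
      where
      g : Carrier → Carrier → Carrier
      g a t = (t + ρ * a) ^ e + (t + a) ^ e + t ^ e
      inner : ∀ a → ∑ (λ t → χ (g a t)) ≡ 0ℤ
      inner a = ≡.trans
        (ℤSum.sum-cong-≗ (λ i → χ-cong (let t = element i in begin
          (t + ρ * a) ^ e + (t + a) ^ e + t ^ e    ≈⟨ +-assoc _ _ _ ⟩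
          (t + ρ * a) ^ e + ((t + a) ^ e + t ^ e)  ≈⟨ +-comm _ _ ⟩
          (t + a) ^ e + t ^ e + (t + ρ * a) ^ e    ≈⟨ +-congʳ (+-comm _ _) ⟩
          t ^ e + (t + a) ^ e + (t + ρ * a) ^ e    ≈⟨ three-powers 1+1≈0 j t a ρ ⟩
          Inverse.to π t                           ∎)))
        -- Undoing the permutation π turns the inner sum into the full character sum.
        (≡.trans (≡.sym (sum-reindex ℤ.+-0-commutativeMonoid χ χ-cong π)) ∑χ≡0)
        where
        π : Inverse carrierSetoid carrierSetoid
        π = affinePower ((1# + ρ) * a) ((ρ ^ (2 ^ℕ j) + ρ) * a ^ e)

theorem9p2 :
    ∀ {c ℓ : Level} (n j : ℕ) → ¬ (2 ∣ n) → 1 ≤ j →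
    (gcd (2 ^ℕ j +ℕ 1) (2 ^ℕ n ∸ 1) ≡ 1) ×
    ((F : FiniteField (2 ^ℕ n) c ℓ) →
     let open BinaryField {n} F
         e = 2 ^ℕ j +ℕ 1
         ψ = λ (x : Carrier) → x ^ e
     in
       Bijective _≈_ _≈_ ψ
       × (∀ ρ → ¬ (ρ ≈ 0#) → ¬ (ρ ≈ 1#) → r e ρ ≡ 1)
       × (∀ ρ → ¬ (ρ ≈ 0#) → ¬ (ρ ≈ 1#) →
            ∑ (λ t → ∑ (λ a → χ (ψ (t + ρ * a) + ψ (t + a) + ψ t))) ≡ 0ℤ))
theorem9p2 n j odd _ with odd⇒1+k*2 n odd
-- Matching on `≡.refl` makes n literally `1 + k * 2`, so F has the order that `OddDegree` expects.
... | k , ≡.refl = gcd≡1 k j , λ F → let open OddDegree.Gold k F j in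
  power-bijective , (λ ρ _ _ → r≡1 ρ) , (λ ρ _ _ → ∑∑χ≡0 ρ)
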